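{- Let $\mathcal{F}$ be a periodic infinite frieze of positive integers with growth coefficients $(s_k)_{k\ge0}$. Then (1) $s_k\ge 2$ for all $k\ge0$; (2) $s_k\le s_{k+1}$ for all $k\ge0$. Furthermore, the inequalities in (2) are strict when $s_1>2$.
   Context: An infinite frieze of positive integers is an array $(m_{i,j})$, indexed by $i\in\mathbb{Z}$ and $j\ge i-2$, with $m_{i,i-2}=0$, $m_{i,i-1}=1$, with $m_{i,j}$ a positive integer for $j\ge i-1$, and with $m_{i,j}m_{i+1,j+1}-m_{i,j+1}m_{i+1,j}=1$ for all $i$ and all $j\ge i-1$. It is periodic if for some $n\ge1$ one has $m_{i+n,j+n}=m_{i,j}$ for all entries. With $n$ the minimal such period, the growth coefficients are $s_0:=2$ and $s_k:=m_{1,kn}-m_{2,kn-1}$ for $k\ge1$. -}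

module Defs where

open import Data.Nat as ℕ using (ℕ; zero; suc)
open import Data.Integer using (ℤ; +_; _+_; _-_; _*_; _≤_; _<_)
open import Data.Product using (_×_)
open import Relation.Binary.PropositionalEquality using (_≡_)

-- An array (m i j) over i ∈ ℤ, j ≥ i - 2 is represented by a total function
-- on ℤ × ℤ; the values at j < i - 2 are junk that no condition below mentions.
Array : Set
Array = ℤ → ℤ → ℤ

record IsInfiniteFrieze (m : Array) : Set where
  field
    zeros    : ∀ i → m i (i - + 2) ≡ + 0
    ones     : ∀ i → m i (i - + 1) ≡ + 1
    positive : ∀ i j → i - + 1 ≤ j → + 0 < m i j
    diamond  : ∀ i j → i - + 1 ≤ j →
               m i j * m (i + + 1) (j + + 1) - m i (j + + 1) * m (i + + 1) j ≡ + 1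

IsPeriod : Array → ℕ → Set
IsPeriod m n = 1 ℕ.≤ n × (∀ i j → i - + 2 ≤ j → m (i + + n) (j + + n) ≡ m i j)

IsMinimalPeriod : Array → ℕ → Set
IsMinimalPeriod m n = IsPeriod m n × (∀ n′ → IsPeriod m n′ → n ℕ.≤ n′)

-- The growth coefficients are those of the frieze when n is its minimal period.
-- For n ≥ 1 both entries used lie in the region j ≥ i - 2.
growthCoefficient : Array → ℕ → ℕ → ℤ
growthCoefficient m n zero    = + 2
growthCoefficient m n (suc k) =
  m (+ 1) (+ (suc k ℕ.* n)) - m (+ 2) (+ (suc k ℕ.* n) - + 1)

{-# OPTIONS --safe #-}

-- Each row of a frieze solves the linear recurrence u (j+2) + u j = a (j+2) u (j+1),
-- where a j = m j j is the quiddity sequence.  The quiddity sequence has period n, so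
-- shifting by n acts on the plane of solutions spanned by rows 1 and 2; the diamond
-- rule says that this action has determinant 1, and its trace is s₁.  By
-- Cayley–Hamilton, s (k+2) = s₁ s (k+1) - s k, and the positive entries
-- x k = m 1 (kn - 1) obey x 2 = s₁ x 1 and x 3 = s₁ x 2 - x 1, which excludes s₁ ≤ 1.
-- Monotonicity is then read off from
-- s (k+2) - s (k+1) = (s₁ - 2) s (k+1) + (s (k+1) - s k).
module Submission where

open import Data.Nat as ℕ using (ℕ; zero; suc; z≤n; s≤s; _∸_)
import Data.Nat.Properties as ℕₚ
open import Algebra.Properties.CommutativeSemigroup ℕₚ.+-commutativeSemigroup
  using (x∙yz≈y∙xz)
open import Data.Integer hiding (suc; positive)
open import Data.Integer.Properties
open import Algebra.Properties.AbelianGroup +-0-abelianGroup using (∙-cancelʳ)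
open import Data.Integer.Tactic.RingSolver using (solve-∀)
open import Data.Product using (_×_; _,_; proj₁; proj₂)
open import Relation.Nullary using (contradiction)
open import Relation.Binary.PropositionalEquality
open import Defs

open ≡-Reasoning

-- Integer order and cancellation.

i<j⇒0<j-i : ∀ {i j} → i < j → + 0 < j - i
i<j⇒0<j-i {i} {j} i<j = subst (_< j - i) (+-inverseʳ i) (+-monoˡ-< (- i) i<j)

0<i-j⇒j<i : ∀ {i j} → + 0 < i - j → j < i
0<i-j⇒j<i {i} {j} 0<i-j =
  subst₂ _<_ (+-identityˡ j) (i-j+j≡i i j) (+-monoˡ-< j 0<i-j)
  where
  i-j+j≡i : ∀ i j → (i - j) + j ≡ i
  i-j+j≡i = solve-∀

-- Separates an equation that holds modulo a hypothesis `p ≡ q` into that hypothesis and a pure ring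
-- identity with cofactor `t`.
difference-cancel : ∀ {x y p q} t → x - y ≡ t * (p - q) → p ≡ q → x ≡ y
difference-cancel {x} {y} {p} {q} t eq p≡q = i-j≡0⇒i≡j x y (begin
  x - y        ≡⟨ eq ⟩
  t * (p - q)  ≡⟨ cong (t *_) (i≡j⇒i-j≡0 p≡q) ⟩
  t * + 0      ≡⟨ *-zeroʳ t ⟩
  + 0          ∎)

0<i*j : ∀ {i j} → + 0 < i → + 0 < j → + 0 < i * j
0<i*j {+[1+ _ ]} {+[1+ _ ]} _ _ = +<+ (s≤s z≤n)
0<i*j {+ 0} (+<+ ())
0<i*j {+[1+ _ ]} {+ 0} _ (+<+ ())

0≤i*j : ∀ {i j} → + 0 ≤ i → + 0 ≤ j → + 0 ≤ i * j
0≤i*j {i} {j} 0≤i 0≤j =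
  subst (_≤ i * j) (*-zeroʳ i) (*-monoˡ-≤-nonNeg i ⦃ nonNegative 0≤i ⦄ 0≤j)

-- Solutions of the linear recurrence.

record Solves (c u : ℕ → ℤ) : Set where
  field
    step : ∀ j → u (2 ℕ.+ j) + u j ≡ c j * u (1 ℕ.+ j)

open Solves

solution-unique : ∀ {c u v} → Solves c u → Solves c v →
                  u 0 ≡ v 0 → u 1 ≡ v 1 → ∀ j → u j ≡ v j
solution-unique {c} {u} {v} su sv e₀ e₁ j = proj₁ (go j)
  where
  go : ∀ j → u j ≡ v j × u (suc j) ≡ v (suc j)
  go zero    = e₀ , e₁
  go (suc j) with go j
  ... | e , e′ = e′ , ∙-cancelʳ (u j) (u (2 ℕ.+ j)) (v (2 ℕ.+ j)) (begin
    u (2 ℕ.+ j) + u j  ≡⟨ step su j ⟩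
    c j * u (suc j)    ≡⟨ cong (c j *_) e′ ⟩
    c j * v (suc j)    ≡⟨ step sv j ⟨
    v (2 ℕ.+ j) + v j  ≡⟨ cong (_+_ (v (2 ℕ.+ j))) (sym e) ⟩
    v (2 ℕ.+ j) + u j  ∎)

combination-solves : ∀ {c u v} α β → Solves c u → Solves c v →
                     Solves c (λ j → α * u j - β * v j)
combination-solves {c} {u} {v} α β su sv .step j = begin
  (α * u (2 ℕ.+ j) - β * v (2 ℕ.+ j)) + (α * u j - β * v j)
    ≡⟨ regroup α β (u (2 ℕ.+ j)) (u j) (v (2 ℕ.+ j)) (v j) ⟩
  α * (u (2 ℕ.+ j) + u j) - β * (v (2 ℕ.+ j) + v j)
    ≡⟨ cong₂ (λ x y → α * x - β * y) (step su j) (step sv j) ⟩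
  α * (c j * u (suc j)) - β * (c j * v (suc j))
    ≡⟨ factor α β (c j) (u (suc j)) (v (suc j)) ⟩
  c j * (α * u (suc j) - β * v (suc j)) ∎
  where
  regroup : ∀ α β u₂ u₀ v₂ v₀ →
            (α * u₂ - β * v₂) + (α * u₀ - β * v₀) ≡ α * (u₂ + u₀) - β * (v₂ + v₀)
  regroup = solve-∀
  factor : ∀ α β c u v → α * (c * u) - β * (c * v) ≡ c * (α * u - β * v)
  factor = solve-∀

-- Shift by a period as a 2×2 matrix.

-- For the matrix M with rows `(a, - b)` and `(c, - d)`, this is the first coordinate of M² v = tr M
-- · M v - v, with error term proportional to det M - 1.
cayley-hamilton₁ : ∀ a b c d x y →
  (a * (a * x - b * y) - b * (c * x - d * y)) - ((a - d) * (a * x - b * y) - x)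
    ≡ (- x) * ((b * c - a * d) - + 1)
cayley-hamilton₁ = solve-∀

cayley-hamilton₂ : ∀ a b c d x y →
  (c * (a * x - b * y) - d * (c * x - d * y)) - ((a - d) * (c * x - d * y) - y)
    ≡ (- y) * ((b * c - a * d) - + 1)
cayley-hamilton₂ = solve-∀

-- For the same M, tr M² = (tr M)² - 2 det M.
trace-of-square : ∀ a b c d →
  ((a * a - b * c) - (c * b - d * d)) - ((a - d) * (a - d) - + 2)
    ≡ (- + 2) * ((b * c - a * d) - + 1)
trace-of-square = solve-∀

-- The initial values are those of rows 1 and 2; p is n - 1.
module Monodromy
  {a : ℤ} {c f g : ℕ → ℤ} (p : ℕ)
  (f-solves : Solves c f) (g-solves : Solves c g)
  (f₀ : f 0 ≡ + 1) (f₁ : f 1 ≡ a) (g₀ : g 0 ≡ + 0) (g₁ : g 1 ≡ + 1)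
  (c-periodic : ∀ j → c (suc p ℕ.+ j) ≡ c j) (c-last : c p ≡ a)
  (det : f p * g (suc p) - f (suc p) * g p ≡ + 1)
  where

  n : ℕ
  n = suc p

  shift-solves : ∀ {u} → Solves c u → Solves c (λ j → u (n ℕ.+ j))
  shift-solves {u} su .step j = begin
    u (n ℕ.+ (2 ℕ.+ j)) + u (n ℕ.+ j)
      ≡⟨ cong (λ i → u i + u (n ℕ.+ j)) (trans (ℕₚ.+-suc n (suc j)) (cong suc (ℕₚ.+-suc n j))) ⟩
    u (2 ℕ.+ (n ℕ.+ j)) + u (n ℕ.+ j)
      ≡⟨ step su (n ℕ.+ j) ⟩
    c (n ℕ.+ j) * u (suc (n ℕ.+ j))
      ≡⟨ cong₂ _*_ (c-periodic j) (cong u (sym (ℕₚ.+-suc n j))) ⟩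
    c j * u (n ℕ.+ suc j) ∎

  -- Both sides solve the recurrence because `c` is periodic. The coefficients come from indices 0
  -- and -1: continued one step back, `f` would be 0 and `g` would be -1.
  shift : ∀ {u} → Solves c u → ∀ j → u (n ℕ.+ j) ≡ u n * f j - u p * g j
  shift {u} su = solution-unique (shift-solves su)
    (combination-solves (u n) (u p) f-solves g-solves) at-0 at-1
    where
    initial : ∀ x y → x ≡ x * + 1 - y * + 0
    initial = solve-∀
    drop : ∀ x y → x ≡ (x + y) - y * + 1
    drop = solve-∀
    at-0 : u (n ℕ.+ 0) ≡ u n * f 0 - u p * g 0
    at-0 = begin
      u (n ℕ.+ 0)             ≡⟨ cong u (ℕₚ.+-identityʳ n) ⟩
      u n                     ≡⟨ initial (u n) (u p) ⟩
      u n * + 1 - u p * + 0   ≡⟨ cong₂ (λ x y → u n * x - u p * y) f₀ g₀ ⟨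
      u n * f 0 - u p * g 0   ∎
    at-1 : u (n ℕ.+ 1) ≡ u n * f 1 - u p * g 1
    at-1 = begin
      u (n ℕ.+ 1)                     ≡⟨ cong u (ℕₚ.+-comm n 1) ⟩
      u (suc n)                       ≡⟨ drop (u (suc n)) (u p) ⟩
      (u (suc n) + u p) - u p * + 1   ≡⟨ cong (_- u p * + 1) (step su p) ⟩
      c p * u n - u p * + 1           ≡⟨ cong₂ (λ x y → x - u p * y)
                                           (trans (*-comm (c p) (u n))
                                             (cong (u n *_) (trans c-last (sym f₁))))
                                           (sym g₁) ⟩
      u n * f 1 - u p * g 1           ∎

  shift-twice : ∀ {u} → Solves c u → ∀ j → u (n ℕ.+ (n ℕ.+ j)) ≡
                u n * (f n * f j - f p * g j) - u p * (g n * f j - g p * g j)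
  shift-twice {u} su j = trans (shift su (n ℕ.+ j))
    (cong₂ (λ x y → u n * x - u p * y) (shift f-solves j) (shift g-solves j))

  trace : ℤ
  trace = f n - g p

  f-trace-recurrence : ∀ j → f (n ℕ.+ (n ℕ.+ j)) ≡ trace * f (n ℕ.+ j) - f j
  f-trace-recurrence j = begin
    f (n ℕ.+ (n ℕ.+ j))
      ≡⟨ shift-twice f-solves j ⟩
    f n * (f n * f j - f p * g j) - f p * (g n * f j - g p * g j)
      ≡⟨ difference-cancel (- f j) (cayley-hamilton₁ (f n) (f p) (g n) (g p) (f j) (g j)) det ⟩
    trace * (f n * f j - f p * g j) - f j
      ≡⟨ cong (λ x → trace * x - f j) (shift f-solves j) ⟨
    trace * f (n ℕ.+ j) - f j ∎

  g-trace-recurrence : ∀ j → g (n ℕ.+ (n ℕ.+ j)) ≡ trace * g (n ℕ.+ j) - g j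
  g-trace-recurrence j = begin
    g (n ℕ.+ (n ℕ.+ j))
      ≡⟨ shift-twice g-solves j ⟩
    g n * (f n * f j - f p * g j) - g p * (g n * f j - g p * g j)
      ≡⟨ difference-cancel (- g j) (cayley-hamilton₂ (f n) (f p) (g n) (g p) (f j) (g j)) det ⟩
    trace * (g n * f j - g p * g j) - g j
      ≡⟨ cong (λ x → trace * x - g j) (shift g-solves j) ⟨
    trace * g (n ℕ.+ j) - g j ∎

  -- This is the trace recurrence at index -1, where `f` would vanish.
  f-second : f (n ℕ.+ p) ≡ trace * f p
  f-second = trans (shift f-solves p) (factor (f n) (f p) (g p))
    where
    factor : ∀ a b d → a * b - b * d ≡ (a - d) * b
    factor = solve-∀

  -- The trace of the k-th power of the shift matrix; 2 is the trace of the identity. The index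
  -- `p ℕ.+ k ℕ.* n` is (k+1)n - 1 without subtraction.
  traceOfPower : ℕ → ℤ
  traceOfPower zero    = + 2
  traceOfPower (suc k) = f (suc k ℕ.* n) - g (p ℕ.+ k ℕ.* n)

  traceOfPower-1 : traceOfPower 1 ≡ trace
  traceOfPower-1 = cong₂ (λ i j → f i - g j) (ℕₚ.+-identityʳ n) (ℕₚ.+-identityʳ p)

  traceOfPower-recurrence :
    ∀ k → traceOfPower (2 ℕ.+ k) ≡ traceOfPower 1 * traceOfPower (suc k) - traceOfPower k
  -- Here the trace formula for the zeroth power would need `g` at index -1, so the square is
  -- computed directly.
  traceOfPower-recurrence zero = begin
    traceOfPower 2
      ≡⟨ cong₂ (λ i j → f (n ℕ.+ i) - g j) (ℕₚ.+-identityʳ n)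
           (trans (x∙yz≈y∙xz p n 0) (cong (n ℕ.+_) (ℕₚ.+-identityʳ p))) ⟩
    f (n ℕ.+ n) - g (n ℕ.+ p)
      ≡⟨ cong₂ _-_ (shift f-solves n) (shift g-solves p) ⟩
    (f n * f n - f p * g n) - (g n * f p - g p * g p)
      ≡⟨ difference-cancel (- + 2) (trace-of-square (f n) (f p) (g n) (g p)) det ⟩
    trace * trace - + 2
      ≡⟨ cong (λ t → t * t - + 2) traceOfPower-1 ⟨
    traceOfPower 1 * traceOfPower 1 - + 2 ∎
  traceOfPower-recurrence (suc k) = begin
    f (n ℕ.+ (n ℕ.+ suc k ℕ.* n)) - g (p ℕ.+ (n ℕ.+ (n ℕ.+ k ℕ.* n)))
      ≡⟨ cong (λ i → f (n ℕ.+ (n ℕ.+ suc k ℕ.* n)) - g i)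
           (trans (x∙yz≈y∙xz p n _) (cong (n ℕ.+_) (x∙yz≈y∙xz p n _))) ⟩
    f (n ℕ.+ (n ℕ.+ suc k ℕ.* n)) - g (n ℕ.+ (n ℕ.+ (p ℕ.+ k ℕ.* n)))
      ≡⟨ cong₂ _-_ (f-trace-recurrence _) (g-trace-recurrence _) ⟩
    (trace * f (n ℕ.+ suc k ℕ.* n) - f (suc k ℕ.* n))
      - (trace * g (n ℕ.+ (p ℕ.+ k ℕ.* n)) - g (p ℕ.+ k ℕ.* n))
      ≡⟨ regroup trace (f (n ℕ.+ suc k ℕ.* n)) (f (suc k ℕ.* n))
           (g (n ℕ.+ (p ℕ.+ k ℕ.* n))) (g (p ℕ.+ k ℕ.* n)) ⟩
    trace * (f (n ℕ.+ suc k ℕ.* n) - g (n ℕ.+ (p ℕ.+ k ℕ.* n))) - traceOfPower (suc k)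
      ≡⟨ cong₂ (λ t i → t * (f (n ℕ.+ suc k ℕ.* n) - g i) - traceOfPower (suc k))
           traceOfPower-1 (x∙yz≈y∙xz p n _) ⟨
    traceOfPower 1 * traceOfPower (2 ℕ.+ k) - traceOfPower (suc k) ∎
    where
    regroup : ∀ t x y z w → (t * x - y) - (t * z - w) ≡ t * (x - z) - (y - w)
    regroup = solve-∀

-- Lower bound for the trace.

-- `t ≤ 0` would make `x₂` nonpositive, and `t = 1` would make `x₃` zero.
two≤multiplier : ∀ {t x₁ x₂ x₃} → + 0 < x₁ → + 0 < x₂ → + 0 < x₃ →
                 x₂ ≡ t * x₁ → x₃ ≡ t * x₂ - x₁ → + 2 ≤ t
two≤multiplier {+ suc (suc _)} _ _ _ _ _ = +≤+ (s≤s (s≤s z≤n))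
two≤multiplier {+ 0} _ 0<x₂ _ refl _ = contradiction 0<x₂ (<-irrefl refl)
two≤multiplier {+ 1} {x₁} _ _ 0<x₃ refl refl =
  contradiction 0<x₃ (<-irrefl (sym (vanish x₁)))
  where
  vanish : ∀ x → + 1 * (+ 1 * x) - x ≡ + 0
  vanish = solve-∀
two≤multiplier { -[1+ _ ]} {+[1+ _ ]} _ () _ refl _
two≤multiplier { -[1+ _ ]} {+ 0} (+<+ ())

-- Monotonicity of the trace sequence.

module TraceSequence
  {s : ℕ → ℤ} (s₀ : s 0 ≡ + 2) (2≤s₁ : + 2 ≤ s 1)
  (recurrence : ∀ k → s (2 ℕ.+ k) ≡ s 1 * s (suc k) - s k)
  where

  increment : ∀ k → s (2 ℕ.+ k) - s (suc k) ≡ (s 1 - + 2) * s (suc k) + (s (suc k) - s k)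
  increment k = trans (cong (_- s (suc k)) (recurrence k)) (split (s 1) (s (suc k)) (s k))
    where
    split : ∀ t y x → (t * y - x) - y ≡ (t - + 2) * y + (y - x)
    split = solve-∀

  -- The two bounds need a joint induction: an increment is nonnegative when the current term and
  -- the previous increment are.
  two≤s×s≤next : ∀ k → + 2 ≤ s k × s k ≤ s (suc k)
  two≤s×s≤next zero    = ≤-reflexive (sym s₀) , subst (_≤ s 1) (sym s₀) 2≤s₁
  two≤s×s≤next (suc k) with two≤s×s≤next k
  ... | 2≤s , s≤s′ = 2≤s′ , 0≤i-j⇒j≤i (subst (+ 0 ≤_) (sym (increment k))
    (+-mono-≤ (0≤i*j (i≤j⇒0≤j-i 2≤s₁) (≤-trans (+≤+ z≤n) 2≤s′)) (i≤j⇒0≤j-i s≤s′)))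
    where 2≤s′ = ≤-trans 2≤s s≤s′

  s<next : + 2 < s 1 → ∀ k → s k < s (suc k)
  s<next 2<s₁ zero    = subst (_< s 1) (sym s₀) 2<s₁
  s<next 2<s₁ (suc k) = 0<i-j⇒j<i (subst (+ 0 <_) (sym (increment k))
    -- Strictness comes from the product alone; the previous increment only has to be nonnegative.
    (+-mono-<-≤
      (0<i*j (i<j⇒0<j-i 2<s₁) (<-≤-trans (+<+ (s≤s z≤n)) (proj₁ (two≤s×s≤next (suc k)))))
      (i≤j⇒0≤j-i (proj₂ (two≤s×s≤next k)))))

-- Rows of a frieze as solutions.

module Frieze {m : Array} (frieze : IsInfiniteFrieze m) where
  open IsInfiniteFrieze frieze

  entry : ℕ → ℕ → ℤ
  entry i j = m (+ i) (+ j)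

  in-region : ∀ {i j} → i ℕ.≤ suc j → + i - + 1 ≤ + j
  in-region {zero}  _         = -≤+
  in-region {suc i} (s≤s i≤j) = +≤+ i≤j

  entry-positive : ∀ i j → i ℕ.≤ suc j → + 0 < entry i j
  entry-positive i j i≤1+j = positive (+ i) (+ j) (in-region i≤1+j)

  entry-diamond : ∀ i j → i ℕ.≤ suc j →
    entry i j * entry (suc i) (suc j) - entry i (suc j) * entry (suc i) j ≡ + 1
  entry-diamond i j i≤1+j =
    subst₂ (λ i′ j′ → entry i j * entry i′ j′ - entry i j′ * entry i′ j ≡ + 1)
      (ℕₚ.+-comm i 1) (ℕₚ.+-comm j 1) (diamond (+ i) (+ j) (in-region i≤1+j))

  quiddity : ℕ → ℤ
  quiddity j = entry j j

  -- Two adjacent diamonds show that (m i j + m i (j+2)) / m i (j+1) does not depend on i;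
  -- at i = j + 2 the ratio is the quiddity entry.
  row-recurrence : ∀ d i j → d ℕ.+ i ≡ 2 ℕ.+ j →
    entry i (2 ℕ.+ j) + entry i j ≡ quiddity (2 ℕ.+ j) * entry i (1 ℕ.+ j)
  row-recurrence zero    i j refl = begin
    q + entry i j              ≡⟨ cong (_+_ q) (zeros (+ i)) ⟩
    q + + 0                    ≡⟨ +-identityʳ q ⟩
    q                          ≡⟨ *-identityʳ q ⟨
    q * + 1                    ≡⟨ cong (q *_) (ones (+ i)) ⟨
    q * entry i (1 ℕ.+ j)      ∎
    where
    q = quiddity (2 ℕ.+ j)
  row-recurrence (suc d) i j 1+d+i≡2+j =
    *-cancelʳ-≡ _ _ y₁ ⦃ >-nonZero (entry-positive (suc i) (suc j) (s≤s i≤1+j)) ⦄ (begin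
      (x₂ + x₀) * y₁      ≡⟨ difference-cancel (+ 1) (ratio x₀ x₁ x₂ y₀ y₁ y₂)
                               (trans (entry-diamond i j i≤1+j)
                                 (sym (entry-diamond i (suc j) (ℕₚ.m≤n⇒m≤1+n i≤1+j)))) ⟩
      x₁ * (y₂ + y₀)      ≡⟨ cong (x₁ *_)
                               (row-recurrence d (suc i) j (trans (ℕₚ.+-suc d i) 1+d+i≡2+j)) ⟩
      x₁ * (q * y₁)       ≡⟨ swap x₁ q y₁ ⟩
      (q * x₁) * y₁       ∎)
    where
    q  = quiddity (2 ℕ.+ j)
    x₀ = entry i j
    x₁ = entry i (1 ℕ.+ j)
    x₂ = entry i (2 ℕ.+ j)
    y₀ = entry (suc i) j
    y₁ = entry (suc i) (1 ℕ.+ j)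
    y₂ = entry (suc i) (2 ℕ.+ j)
    i≤1+j : i ℕ.≤ 1 ℕ.+ j
    i≤1+j = subst (i ℕ.≤_) (ℕₚ.suc-injective 1+d+i≡2+j) (ℕₚ.m≤n+m i d)
    ratio : ∀ x₀ x₁ x₂ y₀ y₁ y₂ → (x₂ + x₀) * y₁ - x₁ * (y₂ + y₀) ≡
            + 1 * ((x₀ * y₁ - x₁ * y₀) - (x₁ * y₂ - x₂ * y₁))
    ratio = solve-∀
    swap : ∀ x q y → x * (q * y) ≡ (q * x) * y
    swap = solve-∀

  -- The bound `i ≤ 2` keeps column 0 inside the region j ≥ i - 2, so the recurrence holds from the
  -- start.
  row-solves : ∀ i → i ℕ.≤ 2 → Solves (λ j → quiddity (2 ℕ.+ j)) (entry i)
  row-solves i i≤2 .step j = row-recurrence (2 ℕ.+ j ∸ i) i j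
    (ℕₚ.m∸n+n≡m (ℕₚ.≤-trans i≤2 (ℕₚ.m≤m+n 2 j)))

  quiddity-periodic : ∀ {n} → IsPeriod m n → ∀ j → quiddity (n ℕ.+ j) ≡ quiddity j
  quiddity-periodic {n} (_ , periodic) j =
    trans (cong quiddity (ℕₚ.+-comm n j)) (periodic (+ j) (+ j) (i≤j⇒i-k≤j (+ 2) ≤-refl))

lemma4p3 : (m : Array) → IsInfiniteFrieze m → (n : ℕ) → IsMinimalPeriod m n →
    (∀ k → + 2 ≤ growthCoefficient m n k) ×
    (∀ k → growthCoefficient m n k ≤ growthCoefficient m n (suc k)) ×
    (+ 2 < growthCoefficient m n 1 → ∀ k → growthCoefficient m n k < growthCoefficient m n (suc k))
lemma4p3 m frieze zero    ((() , _) , _)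
lemma4p3 m frieze (suc p) (period , _) =
  (λ k → proj₁ (two≤s×s≤next k)) , (λ k → proj₂ (two≤s×s≤next k)) , s<next
  where
  open Frieze frieze
  open IsInfiniteFrieze frieze

  -- Rows 1 and 2 are read from column 0, so coefficient `j` is quiddity entry j + 2; the last one,
  -- at n + 1, equals the entry at 1. The determinant is the diamond in row 1 at column n - 1.
  open Monodromy p
    (row-solves 1 (s≤s z≤n)) (row-solves 2 ℕₚ.≤-refl)
    (ones (+ 1)) refl (zeros (+ 2)) (ones (+ 2))
    (λ j → trans (cong quiddity (sym (x∙yz≈y∙xz (suc p) 2 j))) (quiddity-periodic period (2 ℕ.+ j)))
    (trans (cong quiddity (ℕₚ.+-comm 1 (suc p))) (quiddity-periodic period 1))
    (entry-diamond 1 p (s≤s z≤n))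

  row₁-positive : ∀ j → + 0 < entry 1 j
  row₁-positive j = entry-positive 1 j (s≤s z≤n)

  2≤trace : + 2 ≤ trace
  -- The three positive values are row 1 at columns n - 1, 2n - 1 and 3n - 1.
  2≤trace = two≤multiplier (row₁-positive p) (row₁-positive (n ℕ.+ p))
    (row₁-positive (n ℕ.+ (n ℕ.+ p))) f-second (f-trace-recurrence p)

  growth≡traceOfPower : ∀ k → growthCoefficient m (suc p) k ≡ traceOfPower k
  growth≡traceOfPower zero    = refl
  growth≡traceOfPower (suc k) = refl

  growth-recurrence : ∀ k → growthCoefficient m n (2 ℕ.+ k) ≡
    growthCoefficient m n 1 * growthCoefficient m n (suc k) - growthCoefficient m n k
  growth-recurrence k = trans (traceOfPower-recurrence k)
    (cong (λ s → traceOfPower 1 * traceOfPower (suc k) - s) (sym (growth≡traceOfPower k)))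

  open TraceSequence {growthCoefficient m n} refl
    (subst (+ 2 ≤_) (sym traceOfPower-1) 2≤trace) growth-recurrence
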